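{- There is an absolute constant $C>0$ such that for all integers $n\ge 2$ and $d\ge 1$ the following holds. Let $G=(V,E)$ be an $n$-vertex undirected graph with two special vertices $s,t\in V$, whose edge weights are of the form $$\mathsf{wt}(e)=a_{e,1}\lambda_1+a_{e,2}\lambda_2+\cdots+a_{e,d}\lambda_d+a_{e,d+1},\qquad a_{e,i}\in\mathbb{R},$$ and let $S\subseteq\mathbb{R}^d$ be a feasible region for $G$, i.e. for every $\overline{x}\in S$ the graph $G$ has no negative-weight edge at $\overline{\lambda}=\overline{x}$. Then $$|\mathrm{MSPC}_S(G)|\le n^{C d\log n},$$ that is, $|\mathrm{MSPC}_S(G)|\in n^{O(d\log n)}$.
   Context: Graphs are simple (no multi-edges or self-loops) and connected. Logarithms are to base 2. The parameters $\overline{\lambda}=(\lambda_1,\dots,\lambda_d)\in\mathbb{R}^d$ are common to the entire graph, while the coefficients $a_{e,i}$ are fixed real constants for each edge. "At $\overline{\lambda}=\overline{x}$" refers to the fixed-edge-weight graph obtained by setting $\overline{\lambda}=\overline{x}$ in all edge weights. The weight of a path is the sum of the weights of its edges. Let $\mathcal{P}_{s,t}$ be the set of (simple) paths from $s$ to $t$ in $G$. For $S\subseteq\mathbb{R}^d$, $\mathrm{MSPC}_S(G)$ is a minimum-sized subset $\mathcal{S}\subseteq\mathcal{P}_{s,t}$ such that for every $\overline{x}\in S$ some path in $\mathcal{S}$ is a shortest path from $s$ to $t$ in $G$ at $\overline{\lambda}=\overline{x}$; $|\mathrm{MSPC}_S(G)|$ denotes its size. When $S=\mathbb{R}^d$ one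 writes $\mathrm{MSPC}(G)$. -}

module Defs where

open import Algebra.Bundles using (CommutativeRing)
open import Data.Fin.Base using (Fin)
open import Data.List.Base using (List; []; _∷_; length; map)
open import Data.List.Relation.Unary.Any using (Any)
open import Data.List.Relation.Unary.Unique.Propositional using (Unique)
open import Data.Nat.Base as ℕ using (ℕ)
open import Data.Product.Base using (Σ; _,_; _×_; ∃; ∃-syntax; proj₁; proj₂)
open import Level using (0ℓ)
open import Relation.Binary.Construct.Closure.ReflexiveTransitive using (Star; ε; _◅_)
open import Relation.Binary.Core using (Rel)
open import Relation.Binary.Definitions using (Symmetric; Decidable)
open import Relation.Binary.Structures using (IsStrictTotalOrder)
open import Relation.Nullary.Negation.Core using (¬_)
open import Relation.Unary using (Pred)
import Algebra.Properties.Semiring.Exp as SemiringExp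
import Algebra.Properties.Semiring.Mult as SemiringMult
import Algebra.Properties.Semiring.Sum as SemiringSum
import Relation.Binary.Construct.StrictToNonStrict as NonStrict

-- The real numbers, axiomatised (categorically) as a complete ordered field.
-- The order is the classical one: trichotomy is part of IsStrictTotalOrder.

record Reals : Set₁ where
  field
    commutativeRing : CommutativeRing 0ℓ 0ℓ

  open CommutativeRing commutativeRing public

  infix 4 _<_

  field
    _<_                : Rel Carrier 0ℓ
    isStrictTotalOrder : IsStrictTotalOrder _≈_ _<_
    0≉1                : ¬ (0# ≈ 1#)
    inverse            : ∀ x → ¬ (x ≈ 0#) → ∃[ y ] x * y ≈ 1#
    +-mono-<           : ∀ x y z → x < y → x + z < y + z
    *-pos              : ∀ x y → 0# < x → 0# < y → 0# < x * y

  open NonStrict _≈_ _<_ public using (_≤_)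

  IsUpperBound : Pred Carrier 0ℓ → Carrier → Set
  IsUpperBound A u = ∀ x → A x → x ≤ u

  -- Completeness.  The value of sup A is unspecified unless A is inhabited
  -- and bounded above.
  field
    sup       : Pred Carrier 0ℓ → Carrier
    sup-upper : ∀ A → ∃ A → ∃ (IsUpperBound A) → IsUpperBound A (sup A)
    sup-least : ∀ A → ∃ A → ∃ (IsUpperBound A) →
                ∀ u → IsUpperBound A u → sup A ≤ u

  open SemiringExp semiring public using (_^_)
  open SemiringMult semiring public using () renaming (_×_ to _·_)
  open SemiringSum semiring public using (sum)

  fromℕ : ℕ → Carrier
  fromℕ k = k · 1#

  -- For x ≥ 1, log₂ x is the supremum of the rationals p / q ≥ 0 (q ≥ 1)
  -- such that 2^(p / q) ≤ x, i.e. 2^p ≤ x^q.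
  log₂ : Carrier → Carrier
  log₂ x = sup λ r → ∃[ p ] ∃[ q ]
    1 ℕ.≤ q × fromℕ q * r ≈ fromℕ p × fromℕ 2 ^ p ≤ x ^ q

  -- For b ≥ 1 and y ≥ 0, the real power b^y is the supremum of the numbers
  -- b^(p / q) over the rationals 0 ≤ p / q ≤ y (q ≥ 1).  Below, z ranges over
  -- the nonnegative numbers with z ≤ b^(p / q), i.e. z^q ≤ b^p.
  infixr 8 _^ᴿ_
  _^ᴿ_ : Carrier → Carrier → Carrier
  b ^ᴿ y = sup λ z → ∃[ p ] ∃[ q ]
    1 ℕ.≤ q × fromℕ p ≤ fromℕ q * y × 0# ≤ z × z ^ q ≤ b ^ p

-- Finite simple connected undirected graphs on the vertex set Fin n.

record Graph (n : ℕ) : Set₁ where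
  infix 4 _~_ _~?_
  field
    _~_       : Rel (Fin n) 0ℓ
    _~?_      : Decidable _~_
    ~-sym     : Symmetric _~_
    ~-irrefl  : ∀ v → ¬ (v ~ v)
    connected : ∀ u v → Star _~_ u v

module _ {n : ℕ} (G : Graph n) where
  open Graph G

  vertices : ∀ {u v} → Star _~_ u v → List (Fin n)
  vertices {u} ε       = u ∷ []
  vertices {u} (_ ◅ w) = u ∷ vertices w

  Path : Fin n → Fin n → Set
  Path s t = Σ (Star _~_ s t) λ w → Unique (vertices w)

  -- Since G is simple, a path is determined by its vertex sequence.
  pathVertices : ∀ {s t} → Path s t → List (Fin n)
  pathVertices p = vertices (proj₁ p)

module Parametric (ℝ : Reals) where
  open Reals ℝ

  Point : ℕ → Set
  Point d = Fin d → Carrier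

  -- The weight of the edge {u , v} is Σᵢ (coeff u v i) λᵢ + const u v; the
  -- values of coeff and const at non-adjacent pairs are irrelevant.
  record Weights {n : ℕ} (G : Graph n) (d : ℕ) : Set where
    open Graph G
    field
      coeff     : Fin n → Fin n → Fin d → Carrier
      const     : Fin n → Fin n → Carrier
      coeff-sym : ∀ {u v} → u ~ v → ∀ i → coeff u v i ≈ coeff v u i
      const-sym : ∀ {u v} → u ~ v → const u v ≈ const v u

  module _ {n d : ℕ} {G : Graph n} (W : Weights G d) where
    open Graph G
    open Weights W

    edgeWeight : Point d → Fin n → Fin n → Carrier
    edgeWeight x u v = sum (λ i → coeff u v i * x i) + const u v

    walkWeight : ∀ {u v} → Point d → Star _~_ u v → Carrier
    walkWeight x ε = 0#
    walkWeight {u} x (_◅_ {j = u′} _ w) = edgeWeight x u u′ + walkWeight x w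

    pathWeight : ∀ {s t} → Point d → Path G s t → Carrier
    pathWeight x p = walkWeight x (proj₁ p)

    Feasible : Pred (Point d) 0ℓ → Set
    Feasible S = ∀ x → S x → ∀ u v → u ~ v → 0# ≤ edgeWeight x u v

    IsShortest : ∀ {s t} → Point d → Path G s t → Set
    IsShortest {s} {t} x p = ∀ (p′ : Path G s t) → pathWeight x p ≤ pathWeight x p′

    -- Lists without repetition stand for finite subsets of the set of paths,
    -- so that length is cardinality.
    record IsCover (S : Pred (Point d) 0ℓ) {s t : Fin n}
                   (𝒮 : List (Path G s t)) : Set where
      field
        distinct : Unique (map (pathVertices G) 𝒮)
        covers   : ∀ x → S x → Any (IsShortest x) 𝒮

    -- A minimum-sized cover exists classically, because there are only
    -- finitely many paths, but is not unique; the size is.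
    record IsMSPC (S : Pred (Point d) 0ℓ) {s t : Fin n}
                  (𝒮 : List (Path G s t)) : Set where
      field
        isCover : IsCover S 𝒮
        minimum : ∀ (𝒯 : List (Path G s t)) → IsCover S 𝒯 → length 𝒮 ℕ.≤ length 𝒯

module Submission where

-- Compute all-pairs shortest walks by repeated squaring: each of the
-- ⌈log₂ n⌉ rounds compares, for every pair of end points, the n candidate
-- midpoints, i.e. it evaluates the signs of n⁴ affine functions of λ.  An
-- arrangement of m hyperplanes in dimension d has at most (1 + m)^(d + 1)
-- sign patterns, so every round multiplies the number of possible outcomes
-- by n^O(d), and n^O(d log n) tables of walks suffice for all λ at once.
-- Nonnegativity of the edge weights is used only at the end, to shortcut
-- the winning walk to a path.

open import Defs
open import Data.Bool.Base using (Bool; true; false)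
import Data.Bool.Properties as Bool
open import Data.Fin.Base using (Fin; zero; suc; combine; remQuot)
import Data.Fin.Properties as Fin
open import Data.List.Base using (List; []; _∷_; length; map; _++_; concatMap; lookup; allFin; deduplicate)
import Data.List.Extrema as Extrema
import Data.List.Membership.DecPropositional as DecMembership
open import Data.List.Membership.Propositional using (_∈_)
open import Data.List.Membership.Propositional.Properties
  using (∈-lookup; ∈-allFin; ∈-map⁺; ∈-++⁺ˡ; ∈-++⁺ʳ)
open import Data.List.Properties as List using (length-map; length-++; length-deduplicate)
open import Data.List.Relation.Unary.All as All using ([]; _∷_)
open import Data.List.Relation.Unary.All.Properties using (¬Any⇒All¬)
open import Data.List.Relation.Unary.AllPairs using ([]; _∷_)
import Data.List.Relation.Unary.AllPairs.Properties as AllPairs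
open import Data.List.Relation.Unary.Any as Any using (Any; here; there)
import Data.List.Relation.Unary.Any.Properties as Any
import Data.List.Relation.Unary.Unique.DecSetoid.Properties as UniqueDecSetoid
open import Data.List.Relation.Unary.Unique.Propositional using (Unique)
open import Data.Nat.Base as ℕ using (ℕ; zero; suc; z≤n; s≤s)
import Data.Nat.Properties as ℕ
open import Data.Product.Base using (Σ; _×_; ∃-syntax; _,_; proj₁; proj₂; map₂)
open import Data.Sum.Base using (_⊎_; inj₁; inj₂)
open import Data.Vec.Base as Vec using (Vec; []; _∷_)
open import Data.Vec.Functional as Vector using (removeAt)
import Data.Vec.Properties as Vec
open import Function.Base using (_∘_)
open import Level using (0ℓ)
open import Relation.Binary.Bundles using (DecSetoid; StrictPartialOrder; TotalOrder)
open import Relation.Binary.Construct.Closure.ReflexiveTransitive using (Star; ε; _◅_; _◅◅_)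
import Relation.Binary.Construct.On as On
import Relation.Binary.Construct.StrictToNonStrict as NonStrict
open import Relation.Binary.Definitions using (tri<; tri≈; tri>)
open import Relation.Binary.PropositionalEquality as ≡ using (_≡_)
import Relation.Binary.Reasoning.Setoid as SetoidReasoning
import Relation.Binary.Reasoning.StrictPartialOrder as SPOReasoning
open import Relation.Binary.Structures using (IsStrictTotalOrder)
open import Relation.Nullary.Decidable
  using (Dec; yes; no; does; dec-true; dec-false; decidable-stable; ¬?)
open import Relation.Nullary.Negation.Core using (¬_; contradiction)
open import Relation.Unary using (Pred)
import Algebra.Properties.CommutativeMonoid.Sum as MonoidSum
import Algebra.Properties.Ring as RingProperties
import Algebra.Properties.Semiring.Mult as SemiringMult
import Algebra.Properties.Semiring.Sum as SemiringSum

-- No single arrangement serves all points: the functions compared in a round are weight differences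
-- of walks selected in earlier rounds. What has been decided so far is kept as a table of walks in
-- which λ does not occur, and each table has an arrangement of its own. Since the counts multiply
-- over the rounds, the number of rounds is what matters: lengthening walks edge by edge would give
-- an exponent of order d n, whereas doubling their length gives d log n. The affine functions are
-- made linear by one extra coordinate, which explains the exponent d + 1. The restriction of a
-- linear form to a hyperplane through the origin is again a linear form in one variable less, so
-- the count is an induction that never leaves linear forms. Whether a sign cell contains a point
-- with h > 0 is not decidable constructively. Completeness of the reals settles it up to double
-- negation, and the double negation is removed where the goal is membership in a finite list.

-- Arithmetic of ordered fields.

module OrderedField (ℝ : Reals) where
  open Reals ℝ
  open RingProperties ring using (-‿distribˡ-*; -‿distribʳ-*; -‿involutive)
  open SemiringMult semiring using (×1-homo-*)
  open IsStrictTotalOrder isStrictTotalOrder public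
    using (compare; _<?_; _≟_)
    renaming (trans to <-trans; irrefl to <-irrefl; asym to <-asym;
              isStrictPartialOrder to <-isStrictPartialOrder;
              <-respʳ-≈ to <-respʳ; <-respˡ-≈ to <-respˡ)

  <-strictPartialOrder : StrictPartialOrder 0ℓ 0ℓ 0ℓ
  <-strictPartialOrder = record { isStrictPartialOrder = <-isStrictPartialOrder }

  ≤-totalOrder : TotalOrder 0ℓ 0ℓ 0ℓ
  ≤-totalOrder = record { isTotalOrder = NonStrict.isTotalOrder _≈_ _<_ isStrictTotalOrder }

  open TotalOrder ≤-totalOrder public
    using () renaming (trans to ≤-trans; reflexive to ≤-reflexive; refl to ≤-refl)

  module ≤-Reasoning = SPOReasoning <-strictPartialOrder

  <⇒≱ : ∀ {x y} → x < y → ¬ (y ≤ x)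
  <⇒≱ x<y (inj₁ y<x) = <-asym x<y y<x
  <⇒≱ x<y (inj₂ y≈x) = <-irrefl (sym y≈x) x<y

  ≮⇒≥ : ∀ {x y} → ¬ (x < y) → y ≤ x
  ≮⇒≥ {x} {y} x≮y with compare x y
  ... | tri< x<y _ _ = contradiction x<y x≮y
  ... | tri≈ _ x≈y _ = inj₂ (sym x≈y)
  ... | tri> _ _ y<x = inj₁ y<x

  +-monoʳ-< : ∀ x {y z} → y < z → x + y < x + z
  +-monoʳ-< x {y} {z} y<z = <-respˡ (+-comm y x) (<-respʳ (+-comm z x) (+-mono-< y z x y<z))

  +-monoʳ-≤ : ∀ x {y z} → y ≤ z → x + y ≤ x + z
  +-monoʳ-≤ x (inj₁ y<z) = inj₁ (+-monoʳ-< x y<z)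
  +-monoʳ-≤ x (inj₂ y≈z) = inj₂ (+-congˡ y≈z)

  +-monoˡ-≤ : ∀ x {y z} → y ≤ z → y + x ≤ z + x
  +-monoˡ-≤ x (inj₁ y<z) = inj₁ (+-mono-< _ _ x y<z)
  +-monoˡ-≤ x (inj₂ y≈z) = inj₂ (+-congʳ y≈z)

  +-mono-≤ : ∀ {w x y z} → w ≤ x → y ≤ z → w + y ≤ x + z
  +-mono-≤ {x = x} {y = y} w≤x y≤z = ≤-trans (+-monoˡ-≤ y w≤x) (+-monoʳ-≤ x y≤z)

  0<y-x⇒x<y : ∀ {x y} → 0# < y + - x → x < y
  0<y-x⇒x<y {x} {y} lt = begin-strict
    x              ≈⟨ +-identityˡ x ⟨
    0# + x         <⟨ +-mono-< _ _ x lt ⟩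
    y + - x + x    ≈⟨ +-assoc y (- x) x ⟩
    y + (- x + x)  ≈⟨ +-congˡ (-‿inverseˡ x) ⟩
    y + 0#         ≈⟨ +-identityʳ y ⟩
    y              ∎
    where open ≤-Reasoning

  x<y⇒0<y-x : ∀ {x y} → x < y → 0# < y + - x
  x<y⇒0<y-x {x} {y} x<y = <-respˡ (-‿inverseʳ x) (+-mono-< x y (- x) x<y)

  x≤0⇒0≤-x : ∀ {x} → x ≤ 0# → 0# ≤ - x
  x≤0⇒0≤-x {x} x≤0 = begin
    0#       ≈⟨ -‿inverseʳ x ⟨
    x + - x  ≤⟨ +-monoˡ-≤ (- x) x≤0 ⟩
    0# + - x ≈⟨ +-identityˡ (- x) ⟩
    - x      ∎
    where open ≤-Reasoning

  *-nonneg : ∀ {x y} → 0# ≤ x → 0# ≤ y → 0# ≤ x * y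
  *-nonneg (inj₁ 0<x) (inj₁ 0<y) = inj₁ (*-pos _ _ 0<x 0<y)
  *-nonneg {x} {y} (inj₂ 0≈x) _ = inj₂ (trans (sym (zeroˡ y)) (*-congʳ 0≈x))
  *-nonneg {x} {y} _ (inj₂ 0≈y) = inj₂ (trans (sym (zeroʳ x)) (*-congˡ 0≈y))

  *-nonneg-nonpos : ∀ {x y} → 0# ≤ x → y ≤ 0# → x * y ≤ 0#
  *-nonneg-nonpos {x} {y} 0≤x y≤0 = begin
    x * y              ≈⟨ +-identityʳ (x * y) ⟨
    x * y + 0#         ≤⟨ +-monoʳ-≤ (x * y) (*-nonneg 0≤x (x≤0⇒0≤-x y≤0)) ⟩
    x * y + x * - y    ≈⟨ distribˡ x y (- y) ⟨
    x * (y + - y)      ≈⟨ *-congˡ (-‿inverseʳ y) ⟩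
    x * 0#             ≈⟨ zeroʳ x ⟩
    0#                 ∎
    where open ≤-Reasoning

  *-monoˡ-< : ∀ {x} → 0# < x → ∀ {y z} → y < z → x * y < x * z
  *-monoˡ-< {x} 0<x {y} {z} y<z = 0<y-x⇒x<y (<-respʳ eq (*-pos x (z + - y) 0<x (x<y⇒0<y-x y<z)))
    where
    eq : x * (z + - y) ≈ x * z + - (x * y)
    eq = trans (distribˡ x z (- y)) (+-congˡ (sym (-‿distribʳ-* x y)))

  *-cancelˡ-≤ : ∀ {x} → 0# < x → ∀ {y z} → x * y ≤ x * z → y ≤ z
  *-cancelˡ-≤ 0<x xy≤xz = ≮⇒≥ λ z<y → <⇒≱ (*-monoˡ-< 0<x z<y) xy≤xz

  *-monoˡ-≤ : ∀ {x} → 0# ≤ x → ∀ {y z} → y ≤ z → x * y ≤ x * z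
  *-monoˡ-≤ (inj₁ 0<x) (inj₁ y<z) = inj₁ (*-monoˡ-< 0<x y<z)
  *-monoˡ-≤ _ (inj₂ y≈z) = inj₂ (*-congˡ y≈z)
  *-monoˡ-≤ {x} (inj₂ 0≈x) {y} {z} _ = inj₂ (trans (0* y) (sym (0* z)))
    where
    0* : ∀ w → x * w ≈ 0#
    0* w = trans (*-congʳ (sym 0≈x)) (zeroˡ w)

  0<1 : 0# < 1#
  0<1 with compare 0# 1#
  ... | tri< 0<1 _ _ = 0<1
  ... | tri≈ _ 0≈1 _ = contradiction 0≈1 0≉1
  ... | tri> _ _ 1<0 = contradiction (inj₁ 1<0) (<⇒≱ (<-respʳ eq (*-pos (- 1#) (- 1#) 0<-1 0<-1)))
    where
    0<-1 : 0# < - 1#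
    0<-1 = <-respʳ (+-identityˡ (- 1#)) (x<y⇒0<y-x 1<0)

    eq : - 1# * - 1# ≈ 1#
    eq = trans (sym (-‿distribˡ-* 1# (- 1#))) (trans (-‿cong (*-identityˡ (- 1#))) (-‿involutive 1#))

  0≤fromℕ : ∀ n → 0# ≤ fromℕ n
  0≤fromℕ zero    = ≤-refl
  0≤fromℕ (suc n) = ≤-trans (≤-reflexive (sym (+-identityˡ 0#))) (+-mono-≤ (inj₁ 0<1) (0≤fromℕ n))

  fromℕ-homo-* : ∀ m n → fromℕ (m ℕ.* n) ≈ fromℕ m * fromℕ n
  fromℕ-homo-* = ×1-homo-*

  fromℕ-homo-^ : ∀ m k → fromℕ (m ℕ.^ k) ≈ fromℕ m ^ k
  fromℕ-homo-^ m zero    = +-identityʳ 1#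
  fromℕ-homo-^ m (suc k) = trans (fromℕ-homo-* m (m ℕ.^ k)) (*-congˡ (fromℕ-homo-^ m k))

  fromℕ-mono-≤ : ∀ {m n} → m ℕ.≤ n → fromℕ m ≤ fromℕ n
  fromℕ-mono-≤ {n = n} z≤n = 0≤fromℕ n
  fromℕ-mono-≤ (s≤s m≤n) = +-monoʳ-≤ 1# (fromℕ-mono-≤ m≤n)

  n<1+n : ∀ n → fromℕ n < fromℕ (suc n)
  n<1+n n = <-respˡ (+-identityˡ (fromℕ n)) (+-mono-< 0# 1# (fromℕ n) 0<1)

  0<fromℕ : ∀ {n} → 1 ℕ.≤ n → 0# < fromℕ n
  0<fromℕ {suc n} _ with 0≤fromℕ n
  ... | inj₁ 0<n = <-trans 0<n (n<1+n n)
  ... | inj₂ 0≈n = <-respˡ (sym 0≈n) (n<1+n n)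

  fromℕ-cancel-≤ : ∀ {m n} → fromℕ m ≤ fromℕ n → m ℕ.≤ n
  fromℕ-cancel-≤ {m} {n} le with m ℕ.≤? n
  ... | yes m≤n = m≤n
  ... | no  m≰n = contradiction le
        (<⇒≱ (begin-strict
          fromℕ n        <⟨ n<1+n n ⟩
          fromℕ (suc n)  ≤⟨ fromℕ-mono-≤ (ℕ.≰⇒> m≰n) ⟩
          fromℕ m        ∎))
    where open ≤-Reasoning

  ^-monoˡ-≤ : ∀ {x y} → 0# ≤ x → x ≤ y → ∀ k → 0# ≤ x ^ k × x ^ k ≤ y ^ k
  ^-monoˡ-≤ 0≤x x≤y zero    = inj₁ 0<1 , ≤-refl
  ^-monoˡ-≤ {x} {y} 0≤x x≤y (suc k) with ^-monoˡ-≤ 0≤x x≤y k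
  ... | 0≤xᵏ , xᵏ≤yᵏ = *-nonneg 0≤x 0≤xᵏ , (begin
    x * x ^ k  ≤⟨ *-monoˡ-≤ 0≤x xᵏ≤yᵏ ⟩
    x * y ^ k  ≈⟨ *-comm x (y ^ k) ⟩
    y ^ k * x  ≤⟨ *-monoˡ-≤ (≤-trans 0≤xᵏ xᵏ≤yᵏ) x≤y ⟩
    y ^ k * y  ≈⟨ *-comm (y ^ k) y ⟩
    y * y ^ k  ∎)
    where open ≤-Reasoning

  ^-pos : ∀ {x} → 0# < x → ∀ k → 0# < x ^ k
  ^-pos 0<x zero    = 0<1
  ^-pos 0<x (suc k) = *-pos _ _ 0<x (^-pos 0<x k)

  ^-monoˡ-< : ∀ {x y} → 0# ≤ x → x < y → ∀ {k} → 1 ℕ.≤ k → x ^ k < y ^ k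
  ^-monoˡ-< {x} {y} 0≤x x<y {suc k} _ = begin-strict
    x * x ^ k  ≤⟨ *-monoˡ-≤ 0≤x (proj₂ (^-monoˡ-≤ 0≤x (inj₁ x<y) k)) ⟩
    x * y ^ k  ≈⟨ *-comm x (y ^ k) ⟩
    y ^ k * x  <⟨ *-monoˡ-< (^-pos (0<y 0≤x) k) x<y ⟩
    y ^ k * y  ≈⟨ *-comm (y ^ k) y ⟩
    y * y ^ k  ∎
    where
    open ≤-Reasoning

    0<y : 0# ≤ x → 0# < y
    0<y (inj₁ 0<x) = <-trans 0<x x<y
    0<y (inj₂ 0≈x) = <-respˡ (sym 0≈x) x<y

  -- Excluded middle for negations, read off the supremum of {0} ∪ {1 | P}.
  ¬⊎¬¬ : (P : Set) → ¬ P ⊎ ¬ ¬ P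
  ¬⊎¬¬ P = decide (0# <? sup A)
    where
    A : Pred Carrier 0ℓ
    A z = z ≈ 0# ⊎ (P × z ≈ 1#)

    bounded : ∃[ u ] IsUpperBound A u
    bounded = 1# , λ { z (inj₁ z≈0) → inj₁ (<-respˡ (sym z≈0) 0<1)
                     ; z (inj₂ (_ , z≈1)) → inj₂ z≈1 }

    inhabited : ∃[ z ] A z
    inhabited = 0# , inj₁ refl

    decide : _ → ¬ P ⊎ ¬ ¬ P
    decide (yes 0<s) = inj₂ λ ¬p → <⇒≱ 0<s
      (sup-least A inhabited bounded 0# λ { z (inj₁ z≈0) → inj₂ z≈0
                                          ; z (inj₂ (p , _)) → contradiction p ¬p })
    decide (no 0≮s) = inj₁ λ p → contradiction
      (≤-trans (sup-upper A inhabited bounded 1# (inj₂ (p , refl))) (≮⇒≥ 0≮s)) (<⇒≱ 0<1)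

-- Logarithms and real powers of natural numbers.

module RealPowers (ℝ : Reals) where
  open Reals ℝ
  open OrderedField ℝ

  module _ {n : ℕ} (2≤n : 2 ℕ.≤ n) where

    private
      instance
        n≢0 : ℕ.NonZero n
        n≢0 = ℕ.>-nonZero (ℕ.≤-trans (s≤s z≤n) 2≤n)

      -- The membership condition of the set that defines `log₂ (fromℕ n)`. As `sup` is specified
      -- only on inhabited bounded sets, both facts about this set come before any use of the
      -- logarithm.
      2ᵖ≤ : ℕ → ℕ → Carrier → Set
      2ᵖ≤ p q r = 1 ℕ.≤ q × fromℕ q * r ≈ fromℕ p × fromℕ 2 ^ p ≤ fromℕ n ^ q

      inhabited : ∃[ r ] ∃[ p ] ∃[ q ] 2ᵖ≤ p q r
      inhabited = 0# , 0 , 1 , s≤s z≤n , zeroʳ _ , (begin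
        1#               ≈⟨ +-identityʳ 1# ⟨
        fromℕ 1          ≤⟨ fromℕ-mono-≤ (ℕ.m^n>0 n 1) ⟩
        fromℕ (n ℕ.^ 1)  ≈⟨ fromℕ-homo-^ n 1 ⟩
        fromℕ n ^ 1      ∎)
        where open ≤-Reasoning

      n≤2ⁿ : ∀ m → m ℕ.≤ 2 ℕ.^ m
      n≤2ⁿ zero    = z≤n
      n≤2ⁿ (suc m) = ℕ.+-mono-≤ (ℕ.m^n>0 2 m) (ℕ.≤-trans (n≤2ⁿ m) (ℕ.m≤m+n (2 ℕ.^ m) 0))

      -- From 2^p ≤ n^q ≤ (2^n)^q follows p ≤ n q, and r is p / q.
      bound : ∀ r → ∃[ p ] ∃[ q ] 2ᵖ≤ p q r → r ≤ fromℕ n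
      bound r (p , q , 1≤q , qr≈p , 2ᵖ≤nᑫ) = *-cancelˡ-≤ (0<fromℕ 1≤q) (begin
        fromℕ q * r        ≈⟨ qr≈p ⟩
        fromℕ p            ≤⟨ fromℕ-mono-≤ p≤nq ⟩
        fromℕ (n ℕ.* q)    ≈⟨ fromℕ-homo-* n q ⟩
        fromℕ n * fromℕ q  ≈⟨ *-comm _ _ ⟩
        fromℕ q * fromℕ n  ∎)
        where
        open ≤-Reasoning

        2ᵖ≤nᑫ′ : 2 ℕ.^ p ℕ.≤ n ℕ.^ q
        2ᵖ≤nᑫ′ = fromℕ-cancel-≤ (begin
          fromℕ (2 ℕ.^ p)  ≈⟨ fromℕ-homo-^ 2 p ⟩
          fromℕ 2 ^ p      ≤⟨ 2ᵖ≤nᑫ ⟩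
          fromℕ n ^ q      ≈⟨ fromℕ-homo-^ n q ⟨
          fromℕ (n ℕ.^ q)  ∎)

        p≤nq : p ℕ.≤ n ℕ.* q
        p≤nq = ℕ.≮⇒≥ λ nq<p → ℕ.<⇒≱ (ℕ.^-monoʳ-< 2 (s≤s (s≤s z≤n)) nq<p)
          (ℕ.≤-trans 2ᵖ≤nᑫ′ (ℕ.≤-trans (ℕ.^-monoˡ-≤ q (n≤2ⁿ n)) (ℕ.≤-reflexive (ℕ.^-*-assoc 2 n q))))

    -- Crude, but it only supplies the natural number N that `m≤nᵖ⇒m≤nʸ` asks for.
    log₂≤n : log₂ (fromℕ n) ≤ fromℕ n
    log₂≤n = sup-least _ inhabited (_ , bound) (fromℕ n) bound

    -- The hypothesis says that k / 2 lies in the set whose supremum is the logarithm, with p = k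
    -- and q = 2.
    2ᵏ≤n²⇒k≤2log₂n : ∀ {k} → 2 ℕ.^ k ℕ.≤ n ℕ.^ 2 → fromℕ k ≤ fromℕ 2 * log₂ (fromℕ n)
    2ᵏ≤n²⇒k≤2log₂n {k} 2ᵏ≤n² with inverse (fromℕ 2) 2≉0
      where
      2≉0 : ¬ (fromℕ 2 ≈ 0#)
      2≉0 2≈0 = <-irrefl (sym 2≈0) (0<fromℕ {2} (s≤s z≤n))
    ... | ½ , 2*½≈1 = begin
      fromℕ k                     ≈⟨ 2*½k≈k ⟨
      fromℕ 2 * (½ * fromℕ k)     ≤⟨ *-monoˡ-≤ (0≤fromℕ 2) (sup-upper _ inhabited (_ , bound) _
                                       (k , 2 , s≤s z≤n , 2*½k≈k , 2ᵏ≤n²′)) ⟩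
      fromℕ 2 * log₂ (fromℕ n)    ∎
      where
      open ≤-Reasoning

      2*½k≈k : fromℕ 2 * (½ * fromℕ k) ≈ fromℕ k
      2*½k≈k = trans (sym (*-assoc _ _ _)) (trans (*-congʳ 2*½≈1) (*-identityˡ _))

      2ᵏ≤n²′ : fromℕ 2 ^ k ≤ fromℕ n ^ 2
      2ᵏ≤n²′ = begin
        fromℕ 2 ^ k      ≈⟨ fromℕ-homo-^ 2 k ⟨
        fromℕ (2 ℕ.^ k)  ≤⟨ fromℕ-mono-≤ 2ᵏ≤n² ⟩
        fromℕ (n ℕ.^ 2)  ≈⟨ fromℕ-homo-^ n 2 ⟩
        fromℕ n ^ 2      ∎

    -- The upper bound N on y only serves to bound the set whose supremum is nʸ.
    m≤nᵖ⇒m≤nʸ : ∀ {m p y} N → m ℕ.≤ n ℕ.^ p → fromℕ p ≤ y → y ≤ fromℕ N → fromℕ m ≤ fromℕ n ^ᴿ y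
    m≤nᵖ⇒m≤nʸ {m} {p} {y} N m≤nᵖ p≤y y≤N =
      sup-upper A (fromℕ m , m∈A) (fromℕ (n ℕ.^ N) , bounded) (fromℕ m) m∈A
      where
      open ≤-Reasoning

      A : Pred Carrier 0ℓ
      A z = ∃[ p ] ∃[ q ] 1 ℕ.≤ q × fromℕ p ≤ fromℕ q * y × 0# ≤ z × z ^ q ≤ fromℕ n ^ p

      m∈A : A (fromℕ m)
      m∈A = p , 1 , s≤s z≤n , p≤1y , 0≤fromℕ m , (begin
        fromℕ m * 1#     ≈⟨ *-identityʳ _ ⟩
        fromℕ m          ≤⟨ fromℕ-mono-≤ m≤nᵖ ⟩
        fromℕ (n ℕ.^ p)  ≈⟨ fromℕ-homo-^ n p ⟩
        fromℕ n ^ p      ∎)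
        where
        p≤1y : fromℕ p ≤ fromℕ 1 * y
        p≤1y = begin
          fromℕ p      ≤⟨ p≤y ⟩
          y            ≈⟨ *-identityˡ y ⟨
          1# * y       ≈⟨ *-congʳ (+-identityʳ 1#) ⟨
          fromℕ 1 * y  ∎

      bounded : IsUpperBound A (fromℕ (n ℕ.^ N))
      bounded z (p , q , 1≤q , p≤qy , 0≤z , zᑫ≤nᵖ) =
        ≮⇒≥ λ nᴺ<z → <⇒≱ (^-monoˡ-< (0≤fromℕ (n ℕ.^ N)) nᴺ<z 1≤q) (begin
          z ^ q                      ≤⟨ zᑫ≤nᵖ ⟩
          fromℕ n ^ p                ≈⟨ fromℕ-homo-^ n p ⟨
          fromℕ (n ℕ.^ p)            ≤⟨ fromℕ-mono-≤ (ℕ.^-monoʳ-≤ n p≤Nq) ⟩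
          fromℕ (n ℕ.^ (N ℕ.* q))    ≡⟨ ≡.cong fromℕ (ℕ.^-*-assoc n N q) ⟨
          fromℕ ((n ℕ.^ N) ℕ.^ q)    ≈⟨ fromℕ-homo-^ (n ℕ.^ N) q ⟩
          fromℕ (n ℕ.^ N) ^ q        ∎)
        where
        p≤Nq : p ℕ.≤ N ℕ.* q
        p≤Nq = fromℕ-cancel-≤ (begin
          fromℕ p            ≤⟨ p≤qy ⟩
          fromℕ q * y        ≤⟨ *-monoˡ-≤ (0≤fromℕ q) y≤N ⟩
          fromℕ q * fromℕ N  ≈⟨ *-comm _ _ ⟩
          fromℕ N * fromℕ q  ≈⟨ fromℕ-homo-* N q ⟨
          fromℕ (N ℕ.* q)    ∎)

-- Linear forms and the number of their sign patterns.

module LinearForms (ℝ : Reals) where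
  open Reals ℝ
  open OrderedField ℝ
  open Parametric ℝ using (Point)
  open MonoidSum +-commutativeMonoid using (sum-cong-≋; ∑-distrib-+; sum-remove)
  open SemiringSum semiring using (*-distribˡ-sum)
  open RingProperties ring using (-‿distribˡ-*)
  open SetoidReasoning setoid

  Form : ℕ → Set
  Form D = Fin D → Carrier

  infixl 6 _⊕_
  infixl 7 _⊙_

  _⊕_ : ∀ {D} → Form D → Form D → Form D
  (f ⊕ g) i = f i + g i

  _⊙_ : ∀ {D} → Carrier → Form D → Form D
  (k ⊙ f) i = k * f i

  eval : ∀ {D} → Form D → Point D → Carrier
  eval f x = sum (λ i → f i * x i)

  eval-⊕ : ∀ {D} (f g : Form D) x → eval (f ⊕ g) x ≈ eval f x + eval g x
  eval-⊕ f g x = trans (sum-cong-≋ (λ i → distribʳ (x i) (f i) (g i)))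
                       (∑-distrib-+ (λ i → f i * x i) (λ i → g i * x i))

  eval-⊙ : ∀ {D} k (f : Form D) x → eval (k ⊙ f) x ≈ k * eval f x
  eval-⊙ k f x = trans (sum-cong-≋ (λ i → *-assoc k (f i) (x i)))
                       (sym (*-distribˡ-sum k (λ i → f i * x i)))

  eval-comm : ∀ {D} (f x : Form D) → eval f x ≈ eval x f
  eval-comm f x = sum-cong-≋ (λ i → *-comm (f i) (x i))

  eval-combination : ∀ {D} (f : Form D) α x β y →
                     eval f (α ⊙ x ⊕ β ⊙ y) ≈ α * eval f x + β * eval f y
  eval-combination f α x β y = begin
    eval f (α ⊙ x ⊕ β ⊙ y)               ≈⟨ eval-comm f (α ⊙ x ⊕ β ⊙ y) ⟩
    eval (α ⊙ x ⊕ β ⊙ y) f               ≈⟨ eval-⊕ (α ⊙ x) (β ⊙ y) f ⟩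
    eval (α ⊙ x) f + eval (β ⊙ y) f      ≈⟨ +-cong (eval-⊙ α x f) (eval-⊙ β y f) ⟩
    α * eval x f + β * eval y f          ≈⟨ +-cong (*-congˡ (eval-comm x f)) (*-congˡ (eval-comm y f)) ⟩
    α * eval f x + β * eval f y          ∎

  eval-zero : ∀ {D} (f : Form D) → (∀ i → f i ≈ 0#) → ∀ x → eval f x ≈ 0#
  eval-zero f f≈0 x = begin
    eval f x                    ≈⟨ sum-cong-≋ (λ i → trans (*-congʳ (trans (f≈0 i) (sym (zeroˡ (f i))))) (*-assoc 0# (f i) (x i))) ⟩
    sum (λ i → 0# * (f i * x i)) ≈⟨ *-distribˡ-sum 0# (λ i → f i * x i) ⟨
    0# * eval f x               ≈⟨ zeroˡ (eval f x) ⟩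
    0#                          ∎

  eliminate : ∀ {D} → Fin (suc D) → Form (suc D) → Carrier → Form (suc D) → Form D
  eliminate i h r f = removeAt (f ⊕ (- (f i * r)) ⊙ h) i

  eval-eliminate : ∀ {D} i (h : Form (suc D)) r → h i * r ≈ 1# → ∀ z → eval h z ≈ 0# →
                   ∀ f → eval (eliminate i h r f) (removeAt z i) ≈ eval f z
  eval-eliminate i h r hᵢr≈1 z hz≈0 f = begin
    eval (removeAt g i) (removeAt z i)                    ≈⟨ +-identityˡ _ ⟨
    0# + eval (removeAt g i) (removeAt z i)               ≈⟨ +-congʳ (trans (*-congʳ gᵢ≈0) (zeroˡ (z i))) ⟨
    g i * z i + eval (removeAt g i) (removeAt z i)        ≈⟨ sum-remove (λ j → g j * z j) ⟨
    eval g z                                              ≈⟨ eval-⊕ f (k ⊙ h) z ⟩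
    eval f z + eval (k ⊙ h) z                             ≈⟨ +-congˡ (eval-⊙ k h z) ⟩
    eval f z + k * eval h z                               ≈⟨ +-congˡ (*-congˡ hz≈0) ⟩
    eval f z + k * 0#                                     ≈⟨ +-congˡ (zeroʳ k) ⟩
    eval f z + 0#                                         ≈⟨ +-identityʳ _ ⟩
    eval f z                                              ∎
    where
    k = - (f i * r)
    g = f ⊕ k ⊙ h

    gᵢ≈0 : g i ≈ 0#
    gᵢ≈0 = begin
      f i + - (f i * r) * h i    ≈⟨ +-congˡ (-‿distribˡ-* (f i * r) (h i)) ⟨
      f i + - (f i * r * h i)    ≈⟨ +-congˡ (-‿cong (*-assoc (f i) r (h i))) ⟩
      f i + - (f i * (r * h i))  ≈⟨ +-congˡ (-‿cong (*-congˡ (trans (*-comm r (h i)) hᵢr≈1))) ⟩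
      f i + - (f i * 1#)         ≈⟨ +-congˡ (-‿cong (*-identityʳ (f i))) ⟩
      f i + - f i                ≈⟨ -‿inverseʳ (f i) ⟩
      0#                         ∎

  -- Two signs, > 0 and ≤ 0, are enough to tell whether one walk is strictly heavier than another.
  positive : Carrier → Bool
  positive a = does (0# <? a)

  positive-cong : ∀ {a b} → a ≈ b → positive a ≡ positive b
  positive-cong {a} {b} a≈b with 0# <? b
  ... | yes 0<b = dec-true (0# <? a) (<-respʳ (sym a≈b) 0<b)
  ... | no  0≮b = dec-false (0# <? a) (λ 0<a → 0≮b (<-respʳ a≈b 0<a))

  -- The asymmetry between α and β is deliberate: one strict coefficient keeps positive values
  -- positive, while β must be allowed to vanish, as it does in `signs-crossing` when x already lies
  -- on h = 0.
  positive-combination : ∀ {α β} → 0# < α → 0# ≤ β → ∀ {a b} → positive a ≡ positive b →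
                         positive (α * a + β * b) ≡ positive a
  positive-combination {α} {β} 0<α 0≤β {a} {b} a~b with 0# <? a | 0# <? b
  ... | yes 0<a | yes 0<b = dec-true (0# <? _) (R.begin-strict
          0#             R.≈⟨ +-identityʳ 0# ⟨
          0# + 0#        R.<⟨ +-mono-< 0# (α * a) 0# (*-pos α a 0<α 0<a) ⟩
          α * a + 0#     R.≤⟨ +-monoʳ-≤ (α * a) (*-nonneg 0≤β (inj₁ 0<b)) ⟩
          α * a + β * b  R.∎)
          where module R = ≤-Reasoning
  ... | no 0≮a | no 0≮b = dec-false (0# <? _) λ 0<s → <⇒≱ 0<s (R.begin
          α * a + β * b  R.≤⟨ +-mono-≤ (*-nonneg-nonpos (inj₁ 0<α) (≮⇒≥ 0≮a)) (*-nonneg-nonpos 0≤β (≮⇒≥ 0≮b)) ⟩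
          0# + 0#        R.≈⟨ +-identityʳ 0# ⟩
          0#             R.∎)
          where module R = ≤-Reasoning

  signs : ∀ {D m} → Vec (Form D) m → Point D → Vec Bool m
  signs fs x = Vec.map (λ f → positive (eval f x)) fs

  -- Homogeneous sign cells are convex cones, so no division is needed.
  signs-combination : ∀ {D m} (fs : Vec (Form D) m) x y → signs fs x ≡ signs fs y →
                      ∀ {α β} → 0# < α → 0# ≤ β → signs fs (α ⊙ x ⊕ β ⊙ y) ≡ signs fs x
  signs-combination []       x y _   0<α 0≤β = ≡.refl
  signs-combination (f ∷ fs) x y x~y {α} {β} 0<α 0≤β = ≡.cong₂ _∷_
    (≡.trans (positive-cong (eval-combination f α x β y))
             (positive-combination 0<α 0≤β (Vec.∷-injectiveˡ x~y)))
    (signs-combination fs x y (Vec.∷-injectiveʳ x~y) 0<α 0≤β)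

  signs-eliminate : ∀ {D m} i (h : Form (suc D)) r → h i * r ≈ 1# → ∀ z → eval h z ≈ 0# →
                    (fs : Vec (Form (suc D)) m) →
                    signs (Vec.map (eliminate i h r) fs) (removeAt z i) ≡ signs fs z
  signs-eliminate i h r hᵢr≈1 z hz≈0 []       = ≡.refl
  signs-eliminate i h r hᵢr≈1 z hz≈0 (f ∷ fs) = ≡.cong₂ _∷_
    (positive-cong (eval-eliminate i h r hᵢr≈1 z hz≈0 f))
    (signs-eliminate i h r hᵢr≈1 z hz≈0 fs)

  zeroOrPivot : ∀ {D} (h : Form D) → (∀ i → h i ≈ 0#) ⊎ ∃[ i ] ¬ (h i ≈ 0#)
  zeroOrPivot h with Fin.any? (λ i → ¬? (h i ≟ 0#))
  ... | yes pivot = inj₂ pivot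
  ... | no  none  = inj₁ λ i → decidable-stable (h i ≟ 0#) (λ hᵢ≉0 → none (i , hᵢ≉0))

  -- The segment from x to y meets h = 0 at h(y) x - h(x) y divided by h(y) - h(x); the witness is
  -- this point without the denominator.
  signs-crossing : ∀ {D m} (fs : Vec (Form D) m) h x y → signs fs x ≡ signs fs y →
                   eval h x ≤ 0# → 0# < eval h y →
                   ∃[ z ] signs fs z ≡ signs fs x × eval h z ≈ 0#
  signs-crossing fs h x y x~y hx≤0 0<hy =
    α ⊙ x ⊕ β ⊙ y , signs-combination fs x y x~y 0<hy (x≤0⇒0≤-x hx≤0) , (begin
      eval h (α ⊙ x ⊕ β ⊙ y)       ≈⟨ eval-combination h α x β y ⟩
      α * eval h x + - eval h x * α  ≈⟨ +-cong (*-comm α (eval h x)) (sym (-‿distribˡ-* (eval h x) α)) ⟩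
      eval h x * α + - (eval h x * α) ≈⟨ -‿inverseʳ (eval h x * α) ⟩
      0#                             ∎)
    where
    α = eval h y
    β = - eval h x

  private
    _∈?_ : ∀ {m} (p : Vec Bool m) ps → Dec (p ∈ ps)
    _∈?_ = DecMembership._∈?_ (Vec.≡-dec Bool._≟_)

  -- Only the cells of fs that meet the hyperplane h = 0 are split by h, and
  -- these are counted in one dimension less.  The points of such a cell with
  -- h > 0 are already covered by extend, hence only false is added for them.
  signPatterns : ∀ {D m} (fs : Vec (Form D) m) →
    ∃[ ps ] length ps ℕ.≤ suc m ℕ.^ D × (∀ x → signs fs x ∈ ps)
  signPatterns {D} [] = [] ∷ [] , ℕ.m^n>0 1 D , λ _ → here ≡.refl
  signPatterns {D} {suc m} (h ∷ fs) with signPatterns fs | zeroOrPivot h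
  ... | ps , |ps|≤ , fs∈ps | inj₁ h≈0 =
    map (false ∷_) ps , |ps|≤′ ,
    λ x → ≡.subst (λ b → b ∷ signs fs x ∈ map (false ∷_) ps) (≡.sym (hx≡false x)) (∈-map⁺ _ (fs∈ps x))
    where
    |ps|≤′ : length (map {B = Vec Bool (suc m)} (false ∷_) ps) ℕ.≤ suc (suc m) ℕ.^ D
    |ps|≤′ = ℕ.≤-trans (ℕ.≤-reflexive (length-map (false ∷_) ps))
               (ℕ.≤-trans |ps|≤ (ℕ.^-monoˡ-≤ D (ℕ.n≤1+n (suc m))))

    hx≡false : ∀ x → positive (eval h x) ≡ false
    hx≡false x = dec-false (0# <? _) (λ 0<hx → <-irrefl (sym (eval-zero h h≈0 x)) 0<hx)
  signPatterns {suc D} {suc m} (h ∷ fs) | ps , |ps|≤ , fs∈ps | inj₂ (i , hᵢ≉0)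
    with inverse (h i) hᵢ≉0
  ... | r , hᵢr≈1 with signPatterns (Vec.map (eliminate i h r) fs)
  ... | qs , |qs|≤ , fs∈qs = map extend ps ++ map (false ∷_) qs , |rs|≤ , ∈rs
    where
    ∈qs : ∀ x → eval h x ≈ 0# → signs fs x ∈ qs
    ∈qs x hx≈0 = ≡.subst (_∈ qs) (signs-eliminate i h r hᵢr≈1 x hx≈0 fs) (fs∈qs (removeAt x i))

    -- `extend` must give each pattern p one sign b before any point is seen. If the cell has no
    -- point with h > 0, then b = false is right everywhere. Otherwise b = true, and a point of the
    -- cell with h ≤ 0 forces a crossing of h = 0, hence p ∈ qs; the positive point exists only
    -- doubly negated, but membership in qs is decidable.
    choice : ∀ p → ∃[ b ] (∀ x → signs fs x ≡ p →
      positive (eval h x) ≡ b ⊎ (positive (eval h x) ≡ false × p ∈ qs))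
    choice p with ¬⊎¬¬ (∃[ y ] signs fs y ≡ p × 0# < eval h y)
    ... | inj₁ none = false , λ x x∈p → inj₁ (dec-false (0# <? _) (λ 0<hx → none (x , x∈p , 0<hx)))
    ... | inj₂ ¬none = true , onCell
      where
      onCell : ∀ x → signs fs x ≡ p → positive (eval h x) ≡ true ⊎ (positive (eval h x) ≡ false × p ∈ qs)
      onCell x x∈p with 0# <? eval h x
      ... | yes _    = inj₁ ≡.refl
      ... | no  0≮hx = inj₂ (≡.refl , decidable-stable (p ∈? qs) λ p∉qs → ¬none λ (y , y∈p , 0<hy) →
        let (z , z~x , hz≈0) = signs-crossing fs h x y (≡.trans x∈p (≡.sym y∈p)) (≮⇒≥ 0≮hx) 0<hy
        in p∉qs (≡.subst (_∈ qs) (≡.trans z~x x∈p) (∈qs z hz≈0)))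

    extend : Vec Bool m → Vec Bool (suc m)
    extend p = proj₁ (choice p) ∷ p

    |rs|≤ : length (map extend ps ++ map (false ∷_) qs) ℕ.≤ suc (suc m) ℕ.^ suc D
    |rs|≤ = R.begin
      length (map extend ps ++ map (false ∷_) qs)       R.≡⟨ length-++ (map extend ps) ⟩
      length (map extend ps) ℕ.+ length (map (false ∷_) qs) R.≡⟨ ≡.cong₂ ℕ._+_ (length-map extend ps) (length-map (false ∷_) qs) ⟩
      length ps ℕ.+ length qs                           R.≤⟨ ℕ.+-mono-≤ |ps|≤ |qs|≤ ⟩
      suc m ℕ.^ suc D ℕ.+ suc m ℕ.^ D                   R.≡⟨ ℕ.+-comm (suc m ℕ.^ suc D) (suc m ℕ.^ D) ⟩
      suc (suc m) ℕ.* suc m ℕ.^ D                       R.≤⟨ ℕ.*-monoʳ-≤ (suc (suc m)) (ℕ.^-monoˡ-≤ D (ℕ.n≤1+n (suc m))) ⟩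
      suc (suc m) ℕ.^ suc D                             R.∎
      where module R = ℕ.≤-Reasoning

    ∈rs : ∀ x → signs (h ∷ fs) x ∈ map extend ps ++ map (false ∷_) qs
    ∈rs x with proj₂ (choice (signs fs x)) x ≡.refl
    ... | inj₁ hx≡b = ∈-++⁺ˡ (≡.subst (λ b → b ∷ signs fs x ∈ map extend ps) (≡.sym hx≡b) (∈-map⁺ extend (fs∈ps x)))
    ... | inj₂ (hx≡false , p∈qs) = ∈-++⁺ʳ (map extend ps)
            (≡.subst (λ b → b ∷ signs fs x ∈ map (false ∷_) qs) (≡.sym hx≡false) (∈-map⁺ _ p∈qs))

-- List lengths, powers of two, and coding of quadruples.

lookup-injective : ∀ {A : Set} {xs : List A} → Unique xs → ∀ {i j} → lookup xs i ≡ lookup xs j → i ≡ j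
lookup-injective (_ ∷ _)    {zero}  {zero}  _   = ≡.refl
lookup-injective (x∉ ∷ _)   {zero}  {suc j} x≡y = contradiction x≡y (All.lookup x∉ (∈-lookup j))
lookup-injective (x∉ ∷ _)   {suc i} {zero}  y≡x = contradiction (≡.sym y≡x) (All.lookup x∉ (∈-lookup i))
lookup-injective (_ ∷ xs!)  {suc i} {suc j} eq  = ≡.cong suc (lookup-injective xs! eq)

length-unique≤ : ∀ {n} {xs : List (Fin n)} → Unique xs → length xs ℕ.≤ n
length-unique≤ {xs = xs} xs! = Fin.injective⇒≤ {f = lookup xs} (lookup-injective xs!)

length-concatMap≤ : ∀ {A B : Set} (f : A → List B) {b} → (∀ x → length (f x) ℕ.≤ b) →
                    ∀ xs → length (concatMap f xs) ℕ.≤ length xs ℕ.* b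
length-concatMap≤ f     |f|≤b []       = z≤n
length-concatMap≤ f {b} |f|≤b (x ∷ xs) = begin
  length (f x ++ concatMap f xs)              ≡⟨ length-++ (f x) ⟩
  length (f x) ℕ.+ length (concatMap f xs)    ≤⟨ ℕ.+-mono-≤ (|f|≤b x) (length-concatMap≤ f |f|≤b xs) ⟩
  b ℕ.+ length xs ℕ.* b                       ∎
  where open ℕ.≤-Reasoning

-- Supplies the number of rounds, in place of the ceiling of a real logarithm. The k for n also
-- serves n + 1 unless n = 2^k, and then 2^(k+1) = 2 n leaves room.
2-power-between : ∀ n → 1 ℕ.≤ n → ∃[ k ] n ℕ.≤ 2 ℕ.^ k × 2 ℕ.^ k ℕ.≤ 2 ℕ.* n
2-power-between (suc zero) _ = 0 , ℕ.≤-refl , s≤s z≤n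
2-power-between (suc n@(suc _)) _ with 2-power-between n (s≤s z≤n)
... | k , n≤2ᵏ , 2ᵏ≤2n with ℕ.m≤n⇒m<n∨m≡n n≤2ᵏ
... | inj₁ n<2ᵏ = k , n<2ᵏ , ℕ.≤-trans 2ᵏ≤2n (ℕ.*-monoʳ-≤ 2 (ℕ.n≤1+n n))
... | inj₂ n≡2ᵏ = suc k , 1+n≤2ᵏ⁺¹ , ℕ.≤-trans (ℕ.≤-reflexive (≡.cong (2 ℕ.*_) (≡.sym n≡2ᵏ))) (ℕ.*-monoʳ-≤ 2 (ℕ.n≤1+n n))
  where
  1+n≤2ᵏ⁺¹ : suc n ℕ.≤ 2 ℕ.^ suc k
  1+n≤2ᵏ⁺¹ = ℕ.≤-trans (ℕ.+-mono-≤ (s≤s z≤n) (ℕ.m≤m+n n 0)) (ℕ.≤-reflexive (≡.cong (2 ℕ.*_) n≡2ᵏ))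

module _ {n : ℕ} where

  _∈?_ : (u : Fin n) (us : List (Fin n)) → Dec (u ∈ us)
  _∈?_ = DecMembership._∈?_ Fin._≟_

  encode : (u v z z′ : Fin n) → Fin (n ℕ.* (n ℕ.* (n ℕ.* n)))
  encode u v z z′ = combine u (combine v (combine z z′))

  decode : Fin (n ℕ.* (n ℕ.* (n ℕ.* n))) → Fin n × Fin n × Fin n × Fin n
  decode = map₂ (map₂ (remQuot n) ∘ remQuot (n ℕ.* n)) ∘ remQuot (n ℕ.* (n ℕ.* n))

  decode-encode : ∀ u v z z′ → decode (encode u v z z′) ≡ (u , v , z , z′)
  decode-encode u v z z′ =
    ≡.trans (≡.cong (map₂ (map₂ (remQuot n) ∘ remQuot (n ℕ.* n))) (Fin.remQuot-combine u _)) (≡.cong (u ,_)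
      (≡.trans (≡.cong (map₂ (remQuot n)) (Fin.remQuot-combine v _)) (≡.cong (v ,_)
        (Fin.remQuot-combine z z′))))

-- Splitting walks and erasing their loops.

module _ {n : ℕ} (G : Graph n) where
  open Graph G

  walkLength : ∀ {u v} → Star _~_ u v → ℕ
  walkLength ε       = 0
  walkLength (_ ◅ w) = suc (walkLength w)

  length-vertices : ∀ {u v} (w : Star _~_ u v) → length (vertices G w) ≡ suc (walkLength w)
  length-vertices ε       = ≡.refl
  length-vertices (_ ◅ w) = ≡.cong suc (length-vertices w)

  -- The vertex z becomes a candidate midpoint. A walk of fewer than ℓ edges is split at its end,
  -- with empty second half, so upper bounds on lengths are all that has to be tracked.
  splitWalk : ∀ {u v} ℓ ℓ′ (w : Star _~_ u v) → walkLength w ℕ.≤ ℓ ℕ.+ ℓ′ →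
              ∃[ z ] Σ (Star _~_ u z) λ w₁ → Σ (Star _~_ z v) λ w₂ →
              walkLength w₁ ℕ.≤ ℓ × walkLength w₂ ℕ.≤ ℓ′ × w ≡ w₁ ◅◅ w₂
  splitWalk zero    ℓ′ w       |w|≤       = _ , ε , w , z≤n , |w|≤ , ≡.refl
  splitWalk (suc ℓ) ℓ′ ε       _          = _ , ε , ε , z≤n , z≤n , ≡.refl
  splitWalk (suc ℓ) ℓ′ (e ◅ w) (s≤s |w|≤) with splitWalk ℓ ℓ′ w |w|≤
  ... | z , w₁ , w₂ , |w₁|≤ , |w₂|≤ , ≡.refl = z , e ◅ w₁ , w₂ , s≤s |w₁|≤ , |w₂|≤ , ≡.refl

  walkLength-path≤ : ∀ {u v} (p : Path G u v) → walkLength (proj₁ p) ℕ.≤ n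
  walkLength-path≤ (w , w!) = ℕ.≤-trans (ℕ.n≤1+n _)
    (≡.subst (ℕ._≤ n) (length-vertices w) (length-unique≤ w!))

  suffixFrom : ∀ {u v z} (p : Path G u v) → z ∈ pathVertices G p → Path G z v
  suffixFrom (ε     , w!)     (here ≡.refl) = ε , w!
  suffixFrom (e ◅ w , w!)     (here ≡.refl) = e ◅ w , w!
  suffixFrom (e ◅ w , _ ∷ w!) (there z∈w)   = suffixFrom (w , w!) z∈w

  -- If u is already on the path, the new edge and the part before u close a cycle, which is
  -- discarded. The decision is an argument so that `prepend-≤` can split on it.
  prepend : ∀ {u u′ v} → u ~ u′ → (p : Path G u′ v) → Dec (u ∈ pathVertices G p) → Path G u v
  prepend e p        (yes u∈p) = suffixFrom p u∈p
  prepend e (w , w!) (no u∉w)  = e ◅ w , ¬Any⇒All¬ _ u∉w ∷ w!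

  eraseLoops : ∀ {u v} → Star _~_ u v → Path G u v
  eraseLoops ε               = ε , [] ∷ []
  eraseLoops {u} (e ◅ w) = prepend e (eraseLoops w) (u ∈? pathVertices G (eraseLoops w))

-- Weights of walks, and the effect of erasing loops on them.

module ShortestPaths (ℝ : Reals) where
  open Reals ℝ
  open OrderedField ℝ
  open RealPowers ℝ
  open LinearForms ℝ
  open Parametric ℝ
  open RingProperties ring using (-1*x≈-x)

  module _ {n d : ℕ} {G : Graph n} (W : Weights G d) where
    open Graph G
    open Weights W
    open ≤-Reasoning

    walkWeight-◅◅ : ∀ x {u v z} (w : Star _~_ u v) (w′ : Star _~_ v z) →
                    walkWeight W x (w ◅◅ w′) ≈ walkWeight W x w + walkWeight W x w′
    walkWeight-◅◅ x ε       w′ = sym (+-identityˡ _)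
    walkWeight-◅◅ x (e ◅ w) w′ = trans (+-congˡ (walkWeight-◅◅ x w w′)) (sym (+-assoc _ _ _))

    -- Walks with equal vertex sequences may differ in their adjacency proofs, which the weight
    -- ignores. This allows paths to be identified by vertex sequence when a cover is deduplicated.
    walkWeight-vertices : ∀ x {u v} (w w′ : Star _~_ u v) → vertices G w ≡ vertices G w′ →
                          walkWeight W x w ≡ walkWeight W x w′
    walkWeight-vertices x ε ε _ = ≡.refl
    -- The longer walk is opened once more so that its vertex list visibly has two entries and
    -- cannot equal a singleton.
    walkWeight-vertices x ε (_ ◅ ε) ()
    walkWeight-vertices x ε (_ ◅ _ ◅ _) ()
    walkWeight-vertices x (_ ◅ ε) ε ()
    walkWeight-vertices x (_ ◅ _ ◅ _) ε ()
    walkWeight-vertices x (e ◅ w) (e′ ◅ w′) eq with head≡ w w′ (List.∷-injectiveʳ eq)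
      where
      head≡ : ∀ {u u′ v} (w : Star _~_ u v) (w′ : Star _~_ u′ v) → vertices G w ≡ vertices G w′ → u ≡ u′
      head≡ ε       ε       eq = List.∷-injectiveˡ eq
      head≡ ε       (_ ◅ _) eq = List.∷-injectiveˡ eq
      head≡ (_ ◅ _) ε       eq = List.∷-injectiveˡ eq
      head≡ (_ ◅ _) (_ ◅ _) eq = List.∷-injectiveˡ eq
    ... | ≡.refl = ≡.cong (edgeWeight W x _ _ +_) (walkWeight-vertices x w w′ (List.∷-injectiveʳ eq))

    module _ {x : Point d} (nonneg : ∀ u v → u ~ v → 0# ≤ edgeWeight W x u v) where

      walkWeight≤◅ : ∀ {u v z} (e : u ~ v) (w : Star _~_ v z) → walkWeight W x w ≤ walkWeight W x (e ◅ w)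
      walkWeight≤◅ e w = ≤-trans (≤-reflexive (sym (+-identityˡ _))) (+-monoˡ-≤ _ (nonneg _ _ e))

      suffixFrom-≤ : ∀ {u v z} (p : Path G u v) (z∈p : z ∈ pathVertices G p) →
                     pathWeight W x (suffixFrom G p z∈p) ≤ pathWeight W x p
      suffixFrom-≤ (ε     , w!)     (here ≡.refl) = ≤-refl
      suffixFrom-≤ (e ◅ w , w!)     (here ≡.refl) = ≤-refl
      suffixFrom-≤ (e ◅ w , _ ∷ w!) (there z∈w)   = ≤-trans (suffixFrom-≤ (w , w!) z∈w) (walkWeight≤◅ e w)

      prepend-≤ : ∀ {u u′ v} (e : u ~ u′) (p : Path G u′ v) u∈?p →
                  pathWeight W x (prepend G e p u∈?p) ≤ edgeWeight W x u u′ + pathWeight W x p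
      prepend-≤ e p (yes u∈p) = ≤-trans (suffixFrom-≤ p u∈p) (walkWeight≤◅ e (proj₁ p))
      prepend-≤ e p (no _)    = ≤-refl

      eraseLoops-≤ : ∀ {u v} (w : Star _~_ u v) → pathWeight W x (eraseLoops G w) ≤ walkWeight W x w
      eraseLoops-≤ ε       = ≤-refl
      eraseLoops-≤ {u} (e ◅ w) = ≤-trans (prepend-≤ e (eraseLoops G w) (u ∈? pathVertices G (eraseLoops G w))) (+-monoʳ-≤ _ (eraseLoops-≤ w))

    -- Walk weights as linear forms in one more variable.

    homogenise : Point d → Point (suc d)
    homogenise x = 1# Vector.∷ x

    edgeForm : Fin n → Fin n → Form (suc d)
    edgeForm u v = const u v Vector.∷ coeff u v

    walkForm : ∀ {u v} → Star _~_ u v → Form (suc d)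
    walkForm ε                     = λ _ → 0#
    walkForm {u} (_◅_ {j = u′} _ w) = edgeForm u u′ ⊕ walkForm w

    eval-edgeForm : ∀ x u v → eval (edgeForm u v) (homogenise x) ≈ edgeWeight W x u v
    eval-edgeForm x u v = trans (+-comm _ _) (+-congˡ (*-identityʳ (const u v)))

    eval-walkForm : ∀ x {u v} (w : Star _~_ u v) → eval (walkForm w) (homogenise x) ≈ walkWeight W x w
    eval-walkForm x ε       = eval-zero (λ _ → 0#) (λ _ → refl) (homogenise x)
    eval-walkForm x {u} (_◅_ {j = u′} e w) = trans (eval-⊕ (edgeForm u u′) (walkForm w) (homogenise x))
      (+-cong (eval-edgeForm x u u′) (eval-walkForm x w))

    excessForm : ∀ {u v} → Star _~_ u v → Star _~_ u v → Form (suc d)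
    excessForm w w′ = walkForm w ⊕ (- 1#) ⊙ walkForm w′

    eval-excessForm : ∀ x {u v} (w w′ : Star _~_ u v) →
                      eval (excessForm w w′) (homogenise x) ≈ walkWeight W x w + - walkWeight W x w′
    eval-excessForm x w w′ = trans (eval-⊕ (walkForm w) ((- 1#) ⊙ walkForm w′) (homogenise x))
      (+-cong (eval-walkForm x w)
        (trans (eval-⊙ (- 1#) (walkForm w′) (homogenise x))
          (trans (-1*x≈-x _) (-‿cong (eval-walkForm x w′)))))

    -- Repeated squaring on tables of walks.

    -- Walks rather than paths, because joining two entries in `via` may visit a vertex twice.
    Table : Set
    Table = ∀ u v → Star _~_ u v

    via : Table → ∀ u v → Fin n → Star _~_ u v
    via T u v z = T u z ◅◅ T z v

    comparisons : Table → Vec (Form (suc d)) (n ℕ.* (n ℕ.* (n ℕ.* n)))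
    comparisons T = Vec.tabulate λ q → let u , v , z , z′ = decode q
                                       in excessForm (via T u v z) (via T u v z′)

    -- σ records, for all u, v, z, z′, whether the candidate via z loses to the one via z′.
    loses : Vec Bool (n ℕ.* (n ℕ.* (n ℕ.* n))) → (u v z z′ : Fin n) → Bool
    loses σ u v z z′ = Vec.lookup σ (encode u v z z′)

    unbeaten? : ∀ σ u v → Dec (∃[ z ] ∀ z′ → loses σ u v z z′ ≡ false)
    unbeaten? σ u v = Fin.any? λ z → Fin.all? λ z′ → loses σ u v z z′ Bool.≟ false

    -- The default u is never used for a σ that comes from a point.
    midpoint : ∀ σ u v → Fin n
    midpoint σ u v with unbeaten? σ u v
    ... | yes (z , _) = z
    ... | no _        = u

    step : Table → Vec Bool (n ℕ.* (n ℕ.* (n ℕ.* n))) → Table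
    step T σ u v = via T u v (midpoint σ u v)

    -- Only the competitors are limited to ℓ edges; the entries of T may be longer. Thus any walk at
    -- all may fill an entry whose end points no walk of at most ℓ edges joins.
    Beats : ℕ → Point d → Table → Set
    Beats ℓ x T = ∀ u v (w : Star _~_ u v) → walkLength G w ℕ.≤ ℓ → walkWeight W x (T u v) ≤ walkWeight W x w

    module _ (x : Point d) (T : Table) where

      private
        σ = signs (comparisons T) (homogenise x)

      loses-signs : ∀ u v z z′ → loses σ u v z z′ ≡
                    positive (walkWeight W x (via T u v z) + - walkWeight W x (via T u v z′))
      loses-signs u v z z′ = ≡.trans (Vec.lookup-map (encode u v z z′) _ (comparisons T))
        (≡.trans (≡.cong (λ f → positive (eval f (homogenise x))) form≡)
                 (positive-cong (eval-excessForm x (via T u v z) (via T u v z′))))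
        where
        form≡ : Vec.lookup (comparisons T) (encode u v z z′) ≡ excessForm (via T u v z) (via T u v z′)
        form≡ = ≡.trans (Vec.lookup∘tabulate _ (encode u v z z′))
          (≡.cong (λ (u , v , z , z′) → excessForm (via T u v z) (via T u v z′)) (decode-encode u v z z′))

      midpoint-optimal : ∀ u v z → walkWeight W x (via T u v (midpoint σ u v)) ≤ walkWeight W x (via T u v z)
      midpoint-optimal u v z with unbeaten? σ u v
      ... | yes (m , unbeaten) = ≮⇒≥ λ z<m → true≢false
              (≡.trans (≡.sym (dec-true (0# <? _) (x<y⇒0<y-x z<m)))
                       (≡.trans (≡.sym (loses-signs u v m z)) (unbeaten z)))
        where
        true≢false : ¬ (true ≡ false)
        true≢false ()
      -- A lightest candidate is unbeaten, which excludes this branch and with it the default of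
      -- `midpoint`.
      ... | no beaten = contradiction (m , λ z′ → ≡.trans (loses-signs u v m z′)
              (dec-false (0# <? (weight m + - weight z′)) λ 0<d → <⇒≱ (0<y-x⇒x<y 0<d) (m-min z′))) beaten
        where
        weight : Fin n → Carrier
        weight z = walkWeight W x (via T u v z)

        -- Here u is just the starting value of the search; `allFin n` contains every vertex anyway.
        m = Extrema.argmin ≤-totalOrder weight u (allFin n)

        m-min : ∀ z′ → weight m ≤ weight z′
        m-min z′ = All.lookup (Extrema.f[argmin]≤f[xs] ≤-totalOrder {f = weight} u (allFin n)) (∈-allFin z′)

      -- Split the competitor at z: the candidate via z is at least as good half by half, and the
      -- selected midpoint is at least as good as z.
      step-beats : ∀ ℓ ℓ′ → Beats ℓ x T → Beats ℓ′ x T → Beats (ℓ ℕ.+ ℓ′) x (step T σ)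
      step-beats ℓ ℓ′ beats beats′ u v w |w|≤ with splitWalk G ℓ ℓ′ w |w|≤
      ... | z , w₁ , w₂ , |w₁|≤ , |w₂|≤ , ≡.refl = begin
        walkWeight W x (step T σ u v)                   ≤⟨ midpoint-optimal u v z ⟩
        walkWeight W x (T u z ◅◅ T z v)                 ≈⟨ walkWeight-◅◅ x (T u z) (T z v) ⟩
        walkWeight W x (T u z) + walkWeight W x (T z v) ≤⟨ +-mono-≤ (beats u z w₁ |w₁|≤) (beats′ z v w₂ |w₂|≤) ⟩
        walkWeight W x w₁ + walkWeight W x w₂           ≈⟨ walkWeight-◅◅ x w₁ w₂ ⟨
        walkWeight W x (w₁ ◅◅ w₂)                       ∎

    -- Connectedness fills the entries for which no walk of length ≤ 1 exists.
    edgeTable : Table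
    edgeTable u v with u Fin.≟ v | u ~? v
    ... | yes ≡.refl | _     = ε
    ... | no _       | yes e = e ◅ ε
    ... | no _       | no _  = connected u v

    edgeTable-beats : ∀ x → Beats 1 x edgeTable
    edgeTable-beats x u v ε _ with u Fin.≟ u | u ~? u
    ... | yes ≡.refl | _ = ≤-refl
    ... | no u≢u     | _ = contradiction ≡.refl u≢u
    edgeTable-beats x u v (e ◅ ε) _ with u Fin.≟ v | u ~? v
    ... | yes ≡.refl | _     = contradiction e (~-irrefl u)
    ... | no _       | yes _ = ≤-refl
    ... | no _       | no ≁  = contradiction e ≁
    edgeTable-beats x _ _ (_ ◅ _ ◅ _) (s≤s ())

    -- The bound of `signPatterns` for n⁴ forms. It counts patterns on all of the (d+1)-dimensional
    -- space, of which the points `homogenise x` are a slice.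
    branching : ℕ
    branching = suc (n ℕ.* (n ℕ.* (n ℕ.* n))) ℕ.^ suc d

    tables : ∀ k → ∃[ Ts ] length Ts ℕ.≤ branching ℕ.^ k × (∀ x → Any (Beats (2 ℕ.^ k) x) Ts)
    tables zero    = edgeTable ∷ [] , s≤s z≤n , λ x → here (edgeTable-beats x)
    tables (suc k) with tables k
    ... | Ts , |Ts|≤ , beat = concatMap successors Ts , |concat|≤ , λ x → Any.concatMap⁺ successors (Any.map (λ {T} → successor-beats x T) (beat x))
      where
      successors : Table → List Table
      successors T = map (step T) (proj₁ (signPatterns (comparisons T)))

      |successors|≤ : ∀ T → length (successors T) ℕ.≤ branching
      |successors|≤ T = ℕ.≤-trans (ℕ.≤-reflexive (length-map (step T) (proj₁ (signPatterns (comparisons T)))))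
                                   (proj₁ (proj₂ (signPatterns (comparisons T))))

      |concat|≤ : length (concatMap successors Ts) ℕ.≤ branching ℕ.^ suc k
      |concat|≤ = ℕ.≤-trans (length-concatMap≤ successors |successors|≤ Ts)
        (ℕ.≤-trans (ℕ.*-monoˡ-≤ branching |Ts|≤) (ℕ.≤-reflexive (ℕ.*-comm (branching ℕ.^ k) branching)))

      successor-beats : ∀ x T → Beats (2 ℕ.^ k) x T → Any (Beats (2 ℕ.^ suc k) x) (successors T)
      successor-beats x T beats = Any.map⁺ (Any.map
        -- `2 ^ suc k` unfolds to `2 ^ k + (2 ^ k + 0)`, hence the shape of the second length.
        (λ { ≡.refl → step-beats x T (2 ℕ.^ k) (2 ℕ.^ k ℕ.+ 0) beats
               (λ u v w |w|≤ → beats u v w (ℕ.≤-trans |w|≤ (ℕ.≤-reflexive (ℕ.+-identityʳ (2 ℕ.^ k))))) })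
        (proj₂ (proj₂ (signPatterns (comparisons T))) (homogenise x)))

    -- From tables to covers, and their size.

    pathDecSetoid : Fin n → Fin n → DecSetoid 0ℓ 0ℓ
    pathDecSetoid s t = On.decSetoid (≡.decSetoid (List.≡-dec Fin._≟_)) (pathVertices G {s} {t})

    -- A path has at most n ≤ ℓ edges, so the entry for s and t is no heavier than any path, and
    -- erasing its loops keeps it so. Different tables may give the same path, hence the
    -- deduplication.
    cover-from-tables : ∀ {S} → Feasible W S → ∀ s t (Ts : List Table) {ℓ} → n ℕ.≤ ℓ →
      (∀ x → Any (Beats ℓ x) Ts) → ∃[ 𝒯 ] IsCover W S {s} {t} 𝒯 × length 𝒯 ℕ.≤ length Ts
    cover-from-tables feasible s t Ts {ℓ} n≤ℓ beat =
      deduplicate _≟ₚ_ ps ,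
      record { distinct = AllPairs.map⁺ (UniqueDecSetoid.deduplicate-! (pathDecSetoid s t) ps)
             ; covers   = λ x x∈S → Any.deduplicate⁺ _≟ₚ_
                            (λ {p} {q} q~p → resp x q p q~p)
                            (Any.map⁺ (Any.map (λ {T} → shortest x x∈S {T}) (beat x))) } ,
      ℕ.≤-trans (length-deduplicate _≟ₚ_ ps) (ℕ.≤-reflexive (length-map toPath Ts))
      where
      open DecSetoid (pathDecSetoid s t) using () renaming (_≟_ to _≟ₚ_)

      toPath : Table → Path G s t
      toPath T = eraseLoops G (T s t)

      ps : List (Path G s t)
      ps = map toPath Ts

      resp : ∀ x (q p : Path G s t) → pathVertices G q ≡ pathVertices G p → IsShortest W x p → IsShortest W x q
      resp x q p q~p p-min p′ = ≤-trans
        (≤-reflexive (reflexive (walkWeight-vertices x (proj₁ q) (proj₁ p) q~p))) (p-min p′)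

      shortest : ∀ x → _ → ∀ {T} → Beats ℓ x T → IsShortest W x (toPath T)
      shortest x x∈S {T} beats p′ = ≤-trans (eraseLoops-≤ (feasible x x∈S) (T s t))
        (beats s t (proj₁ p′) (ℕ.≤-trans (walkLength-path≤ G p′) n≤ℓ))

    -- The 10 is 5 · 2: 1 + n⁴ ≤ 2 n⁴ ≤ n⁵ uses n ≥ 2, and d + 1 ≤ 2 d uses d ≥ 1.
    branching-≤ : 2 ℕ.≤ n → 1 ℕ.≤ d → branching ℕ.≤ n ℕ.^ (10 ℕ.* d)
    branching-≤ 2≤n 1≤d = R.begin
      suc (n ℕ.* (n ℕ.* (n ℕ.* n))) ℕ.^ suc d  R.≤⟨ ℕ.^-monoˡ-≤ (suc d) 1+n⁴≤n⁵ ⟩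
      (n ℕ.^ 5) ℕ.^ suc d                      R.≡⟨ ℕ.^-*-assoc n 5 (suc d) ⟩
      n ℕ.^ (5 ℕ.* suc d)                      R.≤⟨ ℕ.^-monoʳ-≤ n (ℕ.*-monoʳ-≤ 5 (ℕ.+-monoˡ-≤ d 1≤d)) ⟩
      n ℕ.^ (5 ℕ.* (d ℕ.+ d))                  R.≡⟨ ≡.cong (n ℕ.^_) 5*2d≡10*d ⟩
      n ℕ.^ (10 ℕ.* d)                         R.∎
      where
      module R = ℕ.≤-Reasoning

      instance
        n≢0 : ℕ.NonZero n
        n≢0 = ℕ.>-nonZero (ℕ.≤-trans (s≤s z≤n) 2≤n)

      5*2d≡10*d : 5 ℕ.* (d ℕ.+ d) ≡ 10 ℕ.* d
      5*2d≡10*d = ≡.trans (≡.cong (λ e → 5 ℕ.* (d ℕ.+ e)) (≡.sym (ℕ.+-identityʳ d))) (≡.sym (ℕ.*-assoc 5 2 d))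

      n⁴≡ : n ℕ.* (n ℕ.* (n ℕ.* n)) ≡ n ℕ.^ 4
      n⁴≡ = ≡.cong (λ m → n ℕ.* (n ℕ.* (n ℕ.* m))) (≡.sym (ℕ.*-identityʳ n))

      1+n⁴≤n⁵ : suc (n ℕ.* (n ℕ.* (n ℕ.* n))) ℕ.≤ n ℕ.^ 5
      1+n⁴≤n⁵ = R.begin
        suc (n ℕ.* (n ℕ.* (n ℕ.* n)))  R.≡⟨ ≡.cong suc n⁴≡ ⟩
        1 ℕ.+ n ℕ.^ 4                  R.≤⟨ ℕ.+-mono-≤ (ℕ.m^n>0 n 4) (ℕ.m≤m+n (n ℕ.^ 4) 0) ⟩
        2 ℕ.* n ℕ.^ 4                  R.≤⟨ ℕ.*-monoˡ-≤ (n ℕ.^ 4) 2≤n ⟩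
        n ℕ.^ 5                        R.∎

    mspc-≤ : 2 ℕ.≤ n → 1 ℕ.≤ d → ∀ {S} → Feasible W S → ∀ {s t} {𝒮 : List (Path G s t)} → IsMSPC W S 𝒮 →
             ∀ {k} → n ℕ.≤ 2 ℕ.^ k → length 𝒮 ℕ.≤ n ℕ.^ (10 ℕ.* d ℕ.* k)
    mspc-≤ 2≤n 1≤d feasible {s} {t} {𝒮} mspc {k} n≤2ᵏ with tables k
    ... | Ts , |Ts|≤ , beat with cover-from-tables feasible s t Ts n≤2ᵏ beat
    ... | 𝒯 , 𝒯-covers , |𝒯|≤ = R.begin
      length 𝒮                         R.≤⟨ IsMSPC.minimum mspc 𝒯 𝒯-covers ⟩
      length 𝒯                         R.≤⟨ |𝒯|≤ ⟩
      length Ts                        R.≤⟨ |Ts|≤ ⟩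
      branching ℕ.^ k                  R.≤⟨ ℕ.^-monoˡ-≤ k (branching-≤ 2≤n 1≤d) ⟩
      (n ℕ.^ (10 ℕ.* d)) ℕ.^ k         R.≡⟨ ℕ.^-*-assoc n (10 ℕ.* d) k ⟩
      n ℕ.^ (10 ℕ.* d ℕ.* k)           R.∎
      where module R = ℕ.≤-Reasoning

theorem4 : (ℝ : Reals) →
    let open Reals ℝ
        open Parametric ℝ
    in ∃[ C ] 0# < C ×
       (∀ (n d : ℕ) → 2 ℕ.≤ n → 1 ℕ.≤ d →
        (G : Graph n) (W : Weights G d) (s t : Fin n)
        (S : Pred (Point d) 0ℓ) → Feasible W S →
        (𝒮 : List (Path G s t)) → IsMSPC W S 𝒮 →
        fromℕ (length 𝒮) ≤ fromℕ n ^ᴿ (C * fromℕ d * log₂ (fromℕ n)))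
-- 20 = 10 · 2: each round costs a factor of at most n^(10 d), and there are k ≤ 2 log₂ n rounds.
theorem4 ℝ = fromℕ 20 , 0<fromℕ {20} (s≤s z≤n) , bound
  where
  open Reals ℝ
  open OrderedField ℝ
  open RealPowers ℝ
  open Parametric ℝ
  open ShortestPaths ℝ
  open ≤-Reasoning

  bound : ∀ (n d : ℕ) → 2 ℕ.≤ n → 1 ℕ.≤ d →
          (G : Graph n) (W : Weights G d) (s t : Fin n)
          (S : Pred (Point d) 0ℓ) → Feasible W S →
          (𝒮 : List (Path G s t)) → IsMSPC W S 𝒮 →
          fromℕ (length 𝒮) ≤ fromℕ n ^ᴿ (fromℕ 20 * fromℕ d * log₂ (fromℕ n))
  bound n d 2≤n 1≤d G W s t S feasible 𝒮 mspc with 2-power-between n (ℕ.≤-trans (s≤s z≤n) 2≤n)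
  ... | k , n≤2ᵏ , 2ᵏ≤2n =
    m≤nᵖ⇒m≤nʸ 2≤n {p = 10 ℕ.* d ℕ.* k} (20 ℕ.* d ℕ.* n) (mspc-≤ W 2≤n 1≤d feasible mspc {k} n≤2ᵏ) p≤y y≤N
    where
    L = log₂ (fromℕ n)

    20d≈ : fromℕ 20 * fromℕ d ≈ fromℕ (20 ℕ.* d)
    20d≈ = sym (fromℕ-homo-* 20 d)

    -- Rounding the logarithm up costs a factor 2 in 2^k, absorbed by 2 n ≤ n².
    2ᵏ≤n² : 2 ℕ.^ k ℕ.≤ n ℕ.^ 2
    2ᵏ≤n² = ℕ.≤-trans 2ᵏ≤2n (ℕ.≤-trans (ℕ.*-monoˡ-≤ n 2≤n)
              (ℕ.≤-reflexive (≡.cong (n ℕ.*_) (≡.sym (ℕ.*-identityʳ n)))))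

    10d*2≡20d : 10 ℕ.* d ℕ.* 2 ≡ 20 ℕ.* d
    10d*2≡20d = ≡.trans (ℕ.*-comm (10 ℕ.* d) 2) (≡.sym (ℕ.*-assoc 2 10 d))

    p≤y : fromℕ (10 ℕ.* d ℕ.* k) ≤ fromℕ 20 * fromℕ d * L
    p≤y = begin
      fromℕ (10 ℕ.* d ℕ.* k)            ≈⟨ fromℕ-homo-* (10 ℕ.* d) k ⟩
      fromℕ (10 ℕ.* d) * fromℕ k        ≤⟨ *-monoˡ-≤ (0≤fromℕ (10 ℕ.* d)) (2ᵏ≤n²⇒k≤2log₂n 2≤n {k} 2ᵏ≤n²) ⟩
      fromℕ (10 ℕ.* d) * (fromℕ 2 * L)  ≈⟨ *-assoc _ _ _ ⟨
      fromℕ (10 ℕ.* d) * fromℕ 2 * L    ≈⟨ *-congʳ (fromℕ-homo-* (10 ℕ.* d) 2) ⟨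
      fromℕ (10 ℕ.* d ℕ.* 2) * L        ≡⟨ ≡.cong (λ m → fromℕ m * L) 10d*2≡20d ⟩
      fromℕ (20 ℕ.* d) * L              ≈⟨ *-congʳ 20d≈ ⟨
      fromℕ 20 * fromℕ d * L            ∎

    y≤N : fromℕ 20 * fromℕ d * L ≤ fromℕ (20 ℕ.* d ℕ.* n)
    y≤N = begin
      fromℕ 20 * fromℕ d * L            ≈⟨ *-congʳ 20d≈ ⟩
      fromℕ (20 ℕ.* d) * L              ≤⟨ *-monoˡ-≤ (0≤fromℕ (20 ℕ.* d)) (log₂≤n 2≤n) ⟩
      fromℕ (20 ℕ.* d) * fromℕ n        ≈⟨ fromℕ-homo-* (20 ℕ.* d) n ⟨
      fromℕ (20 ℕ.* d ℕ.* n)            ∎
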